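{- Let $q=5^k$ with $k$ a positive odd integer, and for $A,B,C,D\in\mathbb{F}_5$ let $$g_{A,B,C,D}(x)=x\,\frac{(x^2+Ax+B)^2}{(x^2+Cx+D)^2}.$$ Then $g_{A,B,C,D}$ permutes $\mathbb{F}_q$ whenever $[A,B,C,D]$ is one of the following tuples (entries taken modulo $5$): $$[4,2,1,2],\ [4,2,3,3],\ [2,3,4,2],\ [2,3,3,3],\ [1,2,4,2],\ [1,2,2,3],\ [3,3,1,2],\ [3,3,2,3],\ [0,3,0,2],\ [0,2,0,3].$$
   Context: $\mathbb{F}_q$ is the finite field with $q$ elements. A rational function "permutes" a set $S$ if it induces a well-defined bijection of $S$ onto itself. -}

module Defs where

open import Algebra.Bundles using (CommutativeRing)
import Algebra.Definitions as AlgebraDefinitions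
import Algebra.Properties.Semiring.Exp as Exp
import Algebra.Properties.Semiring.Mult as Mult
open import Data.Fin using (Fin; toℕ; #_)
open import Data.List using (List; []; _∷_)
open import Data.Nat using (ℕ)
open import Data.Nat.Divisibility using (_∣_)
open import Data.Product using (_×_; _,_; Σ-syntax; proj₁)
open import Function.Bundles using (Bijection)
open import Function.Structures using (IsBijection)
open import Level using (Level; _⊔_; suc)
open import Relation.Binary.PropositionalEquality using (setoid)
open import Relation.Nullary using (¬_)

Odd : ℕ → Set
Odd n = ¬ (2 ∣ n)

-- A field with exactly q elements, counted up to the setoid equality _≈_.
record FiniteField (c ℓ : Level) (q : ℕ) : Set (suc (c ⊔ ℓ)) where
  field
    commutativeRing : CommutativeRing c ℓ

  open CommutativeRing commutativeRing public
    renaming (setoid to ≈-setoid)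
  open AlgebraDefinitions _≈_ using (Invertible)

  field
    1≉0          : ¬ (1# ≈ 0#)
    ≉0⇒invertible : ∀ {x} → ¬ (x ≈ 0#) → Invertible 1# _*_ x
    enumeration  : Bijection ≈-setoid (setoid (Fin q))

𝔽₅ : Set
𝔽₅ = Fin 5

module _ {c ℓ : Level} {q : ℕ} (F : FiniteField c ℓ q) where
  open FiniteField F
  open Exp semiring using (_^_)
  open Mult semiring using () renaming (_×_ to _·_)

  inverse : ∀ x → ¬ (x ≈ 0#) → Carrier
  inverse x x≉0 = proj₁ (≉0⇒invertible x≉0)

  -- The image n · 1 of a residue n modulo 5; this is the embedding of the
  -- prime field when F has characteristic 5.
  fromF₅ : 𝔽₅ → Carrier
  fromF₅ a = toℕ a · 1#

  record Fraction : Set c where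
    constructor _/_
    field
      numerator denominator : Carrier → Carrier

  -- A fraction is evaluated as written, without cancelling common factors,
  -- so being well-defined on F means that the denominator has no zero in F.
  -- IsBijection also includes compatibility of the induced map with _≈_.
  Permutes : Fraction → Set (c ⊔ ℓ)
  Permutes (num / den) =
    Σ[ den≉0 ∈ (∀ x → ¬ (den x ≈ 0#)) ]
      IsBijection _≈_ _≈_ (λ x → num x * inverse (den x) (den≉0 x))

  g : (A B C D : 𝔽₅) → Fraction
  g A B C D =
    (λ x → x * (x ^ 2 + fromF₅ A * x + fromF₅ B) ^ 2)
    / (λ x → (x ^ 2 + fromF₅ C * x + fromF₅ D) ^ 2)

tuples : List (𝔽₅ × 𝔽₅ × 𝔽₅ × 𝔽₅)
tuples =
    (# 4 , # 2 , # 1 , # 2)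
  ∷ (# 4 , # 2 , # 3 , # 3)
  ∷ (# 2 , # 3 , # 4 , # 2)
  ∷ (# 2 , # 3 , # 3 , # 3)
  ∷ (# 1 , # 2 , # 4 , # 2)
  ∷ (# 1 , # 2 , # 2 , # 3)
  ∷ (# 3 , # 3 , # 1 , # 2)
  ∷ (# 3 , # 3 , # 2 , # 3)
  ∷ (# 0 , # 3 , # 0 , # 2)
  ∷ (# 0 , # 2 , # 0 , # 3)
  ∷ []

{-# OPTIONS --safe #-}
-- Write g = N / D.  Over 𝔽₂₅ the polynomial N(x) D(y) - N(y) D(x) is a constant times
-- (x - y) h h̄ with h and h̄ conjugate, so over 𝔽₅ it is a constant times
-- (x - y) (P² - 2 Q²).  As k is odd, - 1 is not a fourth power in F (z⁴ = - 1 gives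
-- z⁵ = - z, hence z ^ 5 ^ k = - z); in particular 2 is not a square, and if g x = g y
-- with x ≠ y, then P and Q both vanish at (x , y).  A Bézout identity in 𝔽₅[x , y] then
-- makes - 1 a fourth power, usually that of x - y.  The substitution x ↦ m x with
-- m ∈ 𝔽₅ reduces the ten tuples to three.
module Submission where

open import Defs
open import Data.List.Membership.Propositional using (_∈_)
open import Data.Nat using (ℕ; _<_; _^_)
open import Data.Product using (_,_)
open import Level using (Level)

open import Algebra.Bundles using (RawRing)
import Algebra.Properties.CommutativeMonoid.Sum as Sum
import Algebra.Properties.Semiring.Exp as Exp
import Algebra.Properties.Group as GroupProperties
import Algebra.Properties.Semiring.Mult as Mult
import Algebra.Solver.Ring as RingSolver
open import Algebra.Solver.Ring.AlmostCommutativeRing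
  using (fromCommutativeRing; _-Raw-AlmostCommutative⟶_)
open import Data.Empty using (⊥)
open import Data.Fin using (Fin; zero; suc; toℕ; #_; punchIn; punchOut)
import Data.Fin.Properties as Fin
open import Data.Fin.Permutation using (Permutation′; _⟨$⟩ʳ_)
open import Data.List.Relation.Unary.Any using (here; there)
open import Data.Maybe using (Maybe; just; nothing)
open import Data.Nat as ℕ using (zero; suc)
open import Data.Nat.DivMod using (_mod_; _%_; m≡m%n+[m/n]*n; m%n<n)
  renaming (_/_ to _/ⁿ_)
open import Data.Nat.Divisibility using (m%n≡0⇒n∣m)
import Data.Nat.Properties as ℕ
open import Data.Product using (∃; _×_; proj₁; proj₂)
open import Data.Sum using (_⊎_; inj₁; inj₂; [_,_]′)
open import Data.Vec using (_∷_; [])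
open import Data.Vec.Functional using (Vector; removeAt)
open import Function using (_∘_)
open import Function.Bundles using (module Bijection; mk↔ₛ′)
open import Function.Definitions using (Injective)
import Relation.Binary.Reasoning.Setoid as ≈-Reasoning
open import Relation.Binary.PropositionalEquality as ≡ using (_≡_; _≢_)
open import Level using (_⊔_)
open import Relation.Nullary using (¬_; Dec; yes; no; contradiction)
open import Relation.Nullary.Decidable using (map′)

-- Parity and self-maps of finite sets.

odd⇒1+2* : ∀ {k} → Odd k → ∃ λ j → k ≡ suc (j ℕ.* 2)
odd⇒1+2* {k} odd with k % 2 in eq | m%n<n k 2 | m≡m%n+[m/n]*n k 2
... | 0 | _ | _  = contradiction (m%n≡0⇒n∣m k 2 eq) odd
... | 1 | _ | k≡ = k /ⁿ 2 , k≡
... | suc (suc _) | ℕ.s≤s (ℕ.s≤s ()) | _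

-- Pigeonhole: if `y` were missed, punching it out of the codomain would inject `Fin (suc n)` into
-- `Fin n`.
Fin-injective⇒surjective : ∀ {n} {f : Fin n → Fin n} →
  Injective _≡_ _≡_ f → ∀ y → ∃ λ x → f x ≡ y
Fin-injective⇒surjective {suc n} {f} inj y with Fin.any? (λ x → f x Fin.≟ y)
... | yes hit = hit
... | no miss = contradiction (Fin.injective⇒≤ avoid-injective) ℕ.1+n≰n
  where
  y≢f : ∀ x → y ≢ f x
  y≢f x y≡fx = miss (x , ≡.sym y≡fx)

  avoid : Fin (suc n) → Fin n
  avoid x = punchOut (y≢f x)

  avoid-injective : Injective _≡_ _≡_ avoid
  avoid-injective = inj ∘ Fin.punchOut-injective (y≢f _) (y≢f _)

-- Arithmetic modulo 5.

infixl 6 _+₅_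
infixl 7 _*₅_

_+₅_ _*₅_ : 𝔽₅ → 𝔽₅ → 𝔽₅
a +₅ b = (toℕ a ℕ.+ toℕ b) mod 5
a *₅ b = (toℕ a ℕ.* toℕ b) mod 5

-- Negation as multiplication by 4 avoids truncated subtraction: that it is an additive inverse in F
-- comes down to 5 · 1 = 0.
-₅_ : 𝔽₅ → 𝔽₅
-₅ a = (4 ℕ.* toℕ a) mod 5

𝔽₅-rawRing : RawRing _ _
𝔽₅-rawRing = record
  { Carrier = 𝔽₅ ; _≈_ = _≡_ ; _+_ = _+₅_ ; _*_ = _*₅_ ; -_ = -₅_
  ; 0# = # 0 ; 1# = # 1 }

-- Finite fields: sums and products over all elements, Fermat's theorem, bijections.

module FiniteFieldProperties {c ℓ} {q : ℕ} (F : FiniteField c ℓ q) where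
  open FiniteField F hiding (zero)
  open Exp semiring using () renaming (_^_ to _^ᶠ_)
  open Mult semiring using () renaming (_×_ to _·_)
  open GroupProperties +-group using (identityʳ-unique)
  open ≈-Reasoning ≈-setoid
  module E = Bijection enumeration
  module ∑ = Sum +-commutativeMonoid
  module ∏ = Sum *-commutativeMonoid

  infix 4 _≟_
  _≟_ : ∀ x y → Dec (x ≈ y)
  x ≟ y = map′ E.injective E.cong (E.to x Fin.≟ E.to y)

  element : Fin q → Carrier
  element i = proj₁ (E.surjective i)

  to-element : ∀ i → E.to (element i) ≡ i
  to-element i = proj₂ (E.surjective i) refl

  element-to : ∀ x → element (E.to x) ≈ x
  element-to x = E.injective (to-element (E.to x))

  *-cancelˡ-≉0 : ∀ {x y z} → ¬ (x ≈ 0#) → x * y ≈ x * z → y ≈ z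
  *-cancelˡ-≉0 {x} {y} {z} x≉0 xy≈xz with ≉0⇒invertible x≉0
  ... | x⁻¹ , x⁻¹x≈1 , _ = begin
    y              ≈⟨ *-identityˡ y ⟨
    1# * y         ≈⟨ *-congʳ x⁻¹x≈1 ⟨
    x⁻¹ * x * y    ≈⟨ *-assoc _ _ _ ⟩
    x⁻¹ * (x * y)  ≈⟨ *-congˡ xy≈xz ⟩
    x⁻¹ * (x * z)  ≈⟨ *-assoc _ _ _ ⟨
    x⁻¹ * x * z    ≈⟨ *-congʳ x⁻¹x≈1 ⟩
    1# * z         ≈⟨ *-identityˡ z ⟩
    z              ∎

  xy≈0⇒x≈0∨y≈0 : ∀ {x y} → x * y ≈ 0# → x ≈ 0# ⊎ y ≈ 0#
  xy≈0⇒x≈0∨y≈0 {x} {y} xy≈0 with x ≟ 0#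
  ... | yes x≈0 = inj₁ x≈0
  ... | no  x≉0 = inj₂ (*-cancelˡ-≉0 x≉0 (trans xy≈0 (sym (zeroʳ x))))

  *-≉0 : ∀ {x y} → ¬ (x ≈ 0#) → ¬ (y ≈ 0#) → ¬ (x * y ≈ 0#)
  *-≉0 x≉0 y≉0 xy≈0 = [ x≉0 , y≉0 ]′ (xy≈0⇒x≈0∨y≈0 xy≈0)

  ^-≉0 : ∀ {x} → ¬ (x ≈ 0#) → ∀ n → ¬ (x ^ᶠ n ≈ 0#)
  ^-≉0 x≉0 zero    = 1≉0
  ^-≉0 x≉0 (suc n) = *-≉0 x≉0 (^-≉0 x≉0 n)

  x^n≈0⇒x≈0 : ∀ {x} n → x ^ᶠ n ≈ 0# → x ≈ 0#
  x^n≈0⇒x≈0 {x} n xⁿ≈0 with x ≟ 0#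
  ... | yes x≈0 = x≈0
  ... | no  x≉0 = contradiction xⁿ≈0 (^-≉0 x≉0 n)

  module _ (f f⁻¹ : Carrier → Carrier)
           (f-cong : ∀ {x y} → x ≈ y → f x ≈ f y)
           (f⁻¹-cong : ∀ {x y} → x ≈ y → f⁻¹ x ≈ f⁻¹ y)
           (f∘f⁻¹ : ∀ x → f (f⁻¹ x) ≈ x) (f⁻¹∘f : ∀ x → f⁻¹ (f x) ≈ x) where

    -- Carries a bijection of F over to the indices of the enumeration, so that sums and products
    -- over F can be reindexed along it.
    permutation : Permutation′ q
    permutation = mk↔ₛ′ (E.to ∘ f ∘ element) (E.to ∘ f⁻¹ ∘ element)
      (λ i → ≡.trans (E.cong (trans (f-cong (element-to _)) (f∘f⁻¹ _))) (to-element i))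
      (λ i → ≡.trans (E.cong (trans (f⁻¹-cong (element-to _)) (f⁻¹∘f _))) (to-element i))

  -- Translation by 1 permutes F, so it preserves the sum of all elements; term by term it adds
  -- `q · 1#` to that sum.
  q·1≈0 : q · 1# ≈ 0#
  q·1≈0 = identityʳ-unique (∑.sum element) (q · 1#) (begin
    ∑.sum element + q · 1#                   ≈⟨ +-congˡ (∑.sum-replicate q) ⟨
    ∑.sum element + ∑.sum {q} (λ _ → 1#)     ≈⟨ ∑.∑-distrib-+ element (λ _ → 1#) ⟨
    ∑.sum (λ i → element i + 1#)             ≈⟨ ∑.sum-cong-≋ {q} (λ i → element-to (element i + 1#)) ⟨
    ∑.sum (element ∘ (shift ⟨$⟩ʳ_))           ≈⟨ ∑.sum-permute element shift ⟨
    ∑.sum element                            ∎)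
    where
    cancel : ∀ {a b} → a + b ≈ 0# → ∀ x → (x + a) + b ≈ x
    cancel a+b≈0 x = trans (+-assoc _ _ _) (trans (+-congˡ a+b≈0) (+-identityʳ x))

    shift : Permutation′ q
    shift = permutation (_+ 1#) (_+ - 1#) +-congʳ +-congʳ
      (cancel (-‿inverseˡ 1#)) (cancel (-‿inverseʳ 1#))

  ∏-single : ∀ {n} (i : Fin n) (f : Vector Carrier n) →
    (∀ j → j ≢ i → f j ≈ 1#) → ∏.sum f ≈ f i
  ∏-single {suc n} i f f≈1 = begin
    ∏.sum f                      ≈⟨ ∏.sum-remove {i = i} f ⟩
    f i * ∏.sum (removeAt f i)   ≈⟨ *-congˡ (∏.sum-cong-≋ (λ j → f≈1 (punchIn i j) (Fin.punchInᵢ≢i i j))) ⟩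
    f i * ∏.sum {n} (λ _ → 1#)   ≈⟨ *-congˡ (∏.sum-replicate-zero n) ⟩
    f i * 1#                     ≈⟨ *-identityʳ _ ⟩
    f i                          ∎

  ∏-≉0 : ∀ {n} (f : Vector Carrier n) → (∀ i → ¬ (f i ≈ 0#)) → ¬ (∏.sum f ≈ 0#)
  ∏-≉0 {zero}  f f≉0 = 1≉0
  ∏-≉0 {suc n} f f≉0 = *-≉0 (f≉0 zero) (∏-≉0 (f ∘ suc) (f≉0 ∘ suc))

  caseZero : Carrier → Carrier → Carrier → Carrier
  caseZero u v x with x ≟ 0#
  ... | yes _ = u
  ... | no  _ = v

  caseZero-yes : ∀ u v {x} → x ≈ 0# → caseZero u v x ≈ u
  caseZero-yes u v {x} x≈0 with x ≟ 0#
  ... | yes _   = refl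
  ... | no  x≉0 = contradiction x≈0 x≉0

  caseZero-no : ∀ u v {x} → ¬ (x ≈ 0#) → caseZero u v x ≈ v
  caseZero-no u v {x} x≉0 with x ≟ 0#
  ... | yes x≈0 = contradiction x≈0 x≉0
  ... | no  _   = refl

  -- Multiplication by t permutes F.  With h x = x for x ≉ 0 and h 0 = 1, comparing
  -- the products of h over F before and after gives ∏ w ≈ 1, where w is 1 at 0 and t
  -- elsewhere; supplying the missing factor t at 0 turns ∏ w into t ^ q.
  fermat : ∀ {t} → ¬ (t ≈ 0#) → t ^ᶠ q ≈ t
  fermat {t} t≉0 with ≉0⇒invertible t≉0
  ... | t⁻¹ , t⁻¹t≈1 , tt⁻¹≈1 = begin
    t ^ᶠ q                                ≈⟨ ∏.sum-replicate q ⟨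
    ∏.sum {q} (λ _ → t)                   ≈⟨ ∏.sum-cong-≋ {q} (λ i → v*w≈t (element i)) ⟨
    ∏.sum (λ i → v (element i) * w (element i)) ≈⟨ ∏.∑-distrib-+ (v ∘ element) (w ∘ element) ⟩
    ∏.sum (v ∘ element) * ∏.sum (w ∘ element)   ≈⟨ *-cong ∏v≈t ∏w≈1 ⟩
    t * 1#                                ≈⟨ *-identityʳ t ⟩
    t                                     ∎
    where
    h v w : Carrier → Carrier
    h x = caseZero 1# x x
    v   = caseZero t 1#
    w   = caseZero 1# t

    v*w≈t : ∀ x → v x * w x ≈ t
    v*w≈t x with x ≟ 0#
    ... | yes _ = *-identityʳ t
    ... | no  _ = *-identityˡ t

    h≉0 : ∀ x → ¬ (h x ≈ 0#)
    h≉0 x with x ≟ 0#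
    ... | yes _   = 1≉0
    ... | no  x≉0 = x≉0

    h-cong : ∀ {x y} → x ≈ y → h x ≈ h y
    h-cong {x} {y} x≈y with x ≟ 0#
    ... | yes x≈0 = sym (caseZero-yes 1# y (trans (sym x≈y) x≈0))
    ... | no  x≉0 = trans x≈y (sym (caseZero-no 1# y (λ y≈0 → x≉0 (trans x≈y y≈0))))

    h-scale : ∀ x → h (t * x) ≈ h x * w x
    h-scale x with x ≟ 0#
    ... | yes x≈0 = trans (caseZero-yes 1# (t * x) (trans (*-congˡ x≈0) (zeroʳ t)))
                      (sym (*-identityˡ 1#))
    ... | no  x≉0 = trans (caseZero-no 1# (t * x) (*-≉0 t≉0 x≉0)) (*-comm t x)

    cancel : ∀ {a b} → a * b ≈ 1# → ∀ x → a * (b * x) ≈ x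
    cancel ab≈1 x = trans (sym (*-assoc _ _ _)) (trans (*-congʳ ab≈1) (*-identityˡ x))

    scale : Permutation′ q
    scale = permutation (t *_) (t⁻¹ *_) *-congˡ *-congˡ (cancel tt⁻¹≈1) (cancel t⁻¹t≈1)

    ∏w≈1 : ∏.sum (w ∘ element) ≈ 1#
    ∏w≈1 = *-cancelˡ-≉0 (∏-≉0 (h ∘ element) (h≉0 ∘ element)) (begin
      ∏.sum (h ∘ element) * ∏.sum (w ∘ element)   ≈⟨ ∏.∑-distrib-+ (h ∘ element) (w ∘ element) ⟨
      ∏.sum (λ i → h (element i) * w (element i)) ≈⟨ ∏.sum-cong-≋ {q} (λ i → trans (h-cong (element-to (t * element i))) (h-scale (element i))) ⟨
      ∏.sum (h ∘ element ∘ (scale ⟨$⟩ʳ_))          ≈⟨ ∏.sum-permute (h ∘ element) scale ⟨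
      ∏.sum (h ∘ element)                         ≈⟨ *-identityʳ _ ⟨
      ∏.sum (h ∘ element) * 1#                    ∎)

    ∏v≈t : ∏.sum (v ∘ element) ≈ t
    ∏v≈t = trans
      (∏-single (E.to 0#) (v ∘ element) λ j j≢0 → caseZero-no t 1# λ ej≈0 →
        j≢0 (≡.trans (≡.sym (to-element j)) (E.cong ej≈0)))
      (caseZero-yes t 1# (element-to 0#))

  injective⇒surjective : ∀ {f : Carrier → Carrier} →
    (∀ {x y} → x ≈ y → f x ≈ f y) → Injective _≈_ _≈_ f → ∀ y → ∃ λ x → f x ≈ y
  injective⇒surjective {f} f-cong f-inj y =
    let i , hit = Fin-injective⇒surjective {f = E.to ∘ f ∘ element}
          (λ {i} {j} eq → ≡.trans (≡.sym (to-element i))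
            (≡.trans (E.cong (f-inj (E.injective eq))) (to-element j)))
          (E.to y)
    in element i , E.injective hit

  -- Cross-multiplication turns injectivity into a statement about polynomials, free of inverses;
  -- surjectivity then follows from finiteness.
  permutes : ∀ {num den : Carrier → Carrier} →
    (∀ {x y} → x ≈ y → num x ≈ num y) → (∀ {x y} → x ≈ y → den x ≈ den y) →
    (∀ x → ¬ (den x ≈ 0#)) →
    (∀ {x y} → num x * den y ≈ num y * den x → x ≈ y) →
    Permutes F (num / den)
  permutes {num} {den} num-cong den-cong den≉0 cross-injective = den≉0 , record
    { isInjection = record
      { isCongruent = record
        { cong           = f-cong
        ; isEquivalence₁ = isEquivalence
        ; isEquivalence₂ = isEquivalence
        }
      ; injective = f-injective
      }
    ; surjective = λ y → let x , fx≈y = injective⇒surjective f-cong f-injective y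
                         in x , λ z≈x → trans (f-cong z≈x) fx≈y
    }
    where
    f : Carrier → Carrier
    f x = num x * inverse F (den x) (den≉0 x)

    f*den : ∀ x → f x * den x ≈ num x
    f*den x = trans (*-assoc _ _ _) (trans
      (*-congˡ (proj₁ (proj₂ (≉0⇒invertible (den≉0 x))))) (*-identityʳ _))

    -- The chosen inverse might depend on the representative and on the proof of nonvanishing, so
    -- congruence is obtained by cancelling `den x` instead.
    f-cong : ∀ {x y} → x ≈ y → f x ≈ f y
    f-cong {x} {y} x≈y = *-cancelˡ-≉0 (den≉0 x) (begin
      den x * f x  ≈⟨ *-comm _ _ ⟩
      f x * den x  ≈⟨ f*den x ⟩
      num x        ≈⟨ num-cong x≈y ⟩
      num y        ≈⟨ f*den y ⟨
      f y * den y  ≈⟨ *-congˡ (den-cong x≈y) ⟨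
      f y * den x  ≈⟨ *-comm _ _ ⟩
      den x * f y  ∎)

    f-injective : Injective _≈_ _≈_ f
    f-injective {x} {y} fx≈fy = cross-injective (begin
      num x * den y          ≈⟨ *-congʳ (f*den x) ⟨
      f x * den x * den y    ≈⟨ *-congʳ (*-congʳ fx≈fy) ⟩
      f y * den x * den y    ≈⟨ *-assoc _ _ _ ⟩
      f y * (den x * den y)  ≈⟨ *-congˡ (*-comm _ _) ⟩
      f y * (den y * den x)  ≈⟨ *-assoc _ _ _ ⟨
      f y * den y * den x    ≈⟨ *-congʳ (f*den y) ⟩
      num y * den x          ∎)


-- Characteristic 5, and what odd degree excludes.

module OddDegreeOver𝔽₅ {c ℓ} {k : ℕ} (F : FiniteField c ℓ (5 ^ k)) (odd : Odd k) where
  open FiniteField F hiding (zero)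
  open FiniteFieldProperties F
  open Exp semiring using (^-congˡ; ^-assocʳ) renaming (_^_ to _^ᶠ_)
  open Mult semiring using (×-homo-+; ×-congˡ; ×1-homo-*; ×-homo-1) renaming (_×_ to _·_)
  open GroupProperties +-group using (identityʳ-unique; inverseʳ-unique; x∙y⁻¹≈ε⇒x≈y; x≈y⇒x∙y⁻¹≈ε)
  open ≈-Reasoning ≈-setoid

  ⟦_⟧₅ : 𝔽₅ → Carrier
  ⟦_⟧₅ = fromF₅ F

  ·1-^ : ∀ m n → (m ^ n) · 1# ≈ (m · 1#) ^ᶠ n
  ·1-^ m zero    = ×-homo-1 1#
  ·1-^ m (suc n) = trans (×1-homo-* m (m ^ n)) (*-congˡ (·1-^ m n))

  -- The `k`-th power of `5 · 1#` is `q · 1#`, which vanishes, and a field has no nonzero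
  -- nilpotents.
  5·1≈0 : 5 · 1# ≈ 0#
  5·1≈0 = x^n≈0⇒x≈0 k (trans (sym (·1-^ 5 k)) q·1≈0)

  ⟦mod5⟧ : ∀ n → ⟦ n mod 5 ⟧₅ ≈ n · 1#
  ⟦mod5⟧ n = sym (begin
    n · 1#                                    ≈⟨ ×-congˡ (m≡m%n+[m/n]*n n 5) ⟩
    (n % 5 ℕ.+ n /ⁿ 5 ℕ.* 5) · 1#             ≈⟨ ×-homo-+ 1# (n % 5) (n /ⁿ 5 ℕ.* 5) ⟩
    (n % 5) · 1# + (n /ⁿ 5 ℕ.* 5) · 1#        ≈⟨ +-congˡ (×1-homo-* (n /ⁿ 5) 5) ⟩
    (n % 5) · 1# + (n /ⁿ 5) · 1# * (5 · 1#)   ≈⟨ +-congˡ (trans (*-congˡ 5·1≈0) (zeroʳ _)) ⟩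
    (n % 5) · 1# + 0#                         ≈⟨ +-identityʳ _ ⟩
    (n % 5) · 1#                              ≈⟨ ×-congˡ (Fin.toℕ-fromℕ< (m%n<n n 5)) ⟨
    ⟦ n mod 5 ⟧₅                              ∎)

  ⟦⟧₅-homo-+ : ∀ a b → ⟦ a +₅ b ⟧₅ ≈ ⟦ a ⟧₅ + ⟦ b ⟧₅
  ⟦⟧₅-homo-+ a b = trans (⟦mod5⟧ (toℕ a ℕ.+ toℕ b)) (×-homo-+ 1# (toℕ a) (toℕ b))

  ⟦⟧₅-homo-* : ∀ a b → ⟦ a *₅ b ⟧₅ ≈ ⟦ a ⟧₅ * ⟦ b ⟧₅
  ⟦⟧₅-homo-* a b = trans (⟦mod5⟧ (toℕ a ℕ.* toℕ b)) (×1-homo-* (toℕ a) (toℕ b))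

  ⟦⟧₅-homo-neg : ∀ a → ⟦ -₅ a ⟧₅ ≈ - ⟦ a ⟧₅
  ⟦⟧₅-homo-neg a = inverseʳ-unique _ _ (begin
    ⟦ a ⟧₅ + ⟦ -₅ a ⟧₅             ≈⟨ +-congˡ (⟦mod5⟧ (4 ℕ.* toℕ a)) ⟩
    ⟦ a ⟧₅ + (4 ℕ.* toℕ a) · 1#    ≈⟨ ×-homo-+ 1# (toℕ a) (4 ℕ.* toℕ a) ⟨
    (5 ℕ.* toℕ a) · 1#             ≈⟨ ×1-homo-* 5 (toℕ a) ⟩
    (5 · 1#) * ⟦ a ⟧₅              ≈⟨ *-congʳ 5·1≈0 ⟩
    0# * ⟦ a ⟧₅                    ≈⟨ zeroˡ _ ⟩
    0#                             ∎)

  ⟦⟧₅-≟ : ∀ a b → Maybe (⟦ a ⟧₅ ≈ ⟦ b ⟧₅)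
  ⟦⟧₅-≟ a b with a Fin.≟ b
  ... | yes ≡.refl = just refl
  ... | no  _      = nothing

  -- With coefficients in `𝔽₅`, the ring solver also proves identities that hold only modulo 5.
  ⟦⟧₅-morphism : 𝔽₅-rawRing -Raw-AlmostCommutative⟶ fromCommutativeRing commutativeRing
  ⟦⟧₅-morphism = record
    { ⟦_⟧    = ⟦_⟧₅
    ; +-homo = ⟦⟧₅-homo-+
    ; *-homo = ⟦⟧₅-homo-*
    ; -‿homo = ⟦⟧₅-homo-neg
    ; 0-homo = refl
    ; 1-homo = ×-homo-1 1#
    }

  module S = RingSolver 𝔽₅-rawRing (fromCommutativeRing commutativeRing) ⟦⟧₅-morphism ⟦⟧₅-≟
  open S using
    ( Polynomial; con; var; _:+_; _:*_; _:-_; _:^_; _:=_; ⟦_⟧; ⟦_⟧N; normalise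
    ; solve; prove)

  ⟦unit⟧₅≉0 : ∀ a b → a *₅ b ≡ # 1 → ¬ (⟦ a ⟧₅ ≈ 0#)
  ⟦unit⟧₅≉0 a b ab≡1 a≈0 = 1≉0 (begin
    1#               ≈⟨ ×-homo-1 1# ⟨
    ⟦ # 1 ⟧₅         ≡⟨ ≡.cong ⟦_⟧₅ ab≡1 ⟨
    ⟦ a *₅ b ⟧₅      ≈⟨ ⟦⟧₅-homo-* a b ⟩
    ⟦ a ⟧₅ * ⟦ b ⟧₅  ≈⟨ *-congʳ a≈0 ⟩
    0# * ⟦ b ⟧₅      ≈⟨ zeroˡ _ ⟩
    0#               ∎)

  -- Such a z satisfies z⁵ = - z, hence z ^ 5 ^ k = - z for odd k, against Fermat.
  z⁴≉-1 : ∀ {z} → ¬ (z ^ᶠ 4 ≈ ⟦ # 4 ⟧₅)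
  -- `⟦ # 4 ⟧₅` unfolds to `1# + ⟦ # 3 ⟧₅`, so 4 = 1 would give 3 = 0, although 3 has the inverse 2
  -- modulo 5.
  z⁴≉-1 {z} z⁴≈4 = ⟦unit⟧₅≉0 (# 3) (# 2) ≡.refl (identityʳ-unique 1# ⟦ # 3 ⟧₅ (begin
    ⟦ # 4 ⟧₅   ≈⟨ z⁴≈4 ⟨
    z ^ᶠ 4     ≈⟨ *-cancelˡ-≉0 z≉0 (trans z⁵≈z (sym (*-identityʳ z))) ⟩
    1#         ∎))
    where
    z≉0 : ¬ (z ≈ 0#)
    z≉0 z≈0 = ⟦unit⟧₅≉0 (# 4) (# 4) ≡.refl (begin
      ⟦ # 4 ⟧₅  ≈⟨ z⁴≈4 ⟨
      z ^ᶠ 4    ≈⟨ ^-congˡ 4 z≈0 ⟩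
      0# ^ᶠ 4   ≈⟨ zeroˡ _ ⟩
      0#        ∎)

    z²⁵≈z : (z ^ᶠ 5) ^ᶠ 5 ≈ z
    z²⁵≈z = begin
      (z ^ᶠ 5) ^ᶠ 5         ≈⟨ solve 1 (λ z → (z :^ 5) :^ 5 := z :* (z :^ 4) :^ 6) refl z ⟩
      z * (z ^ᶠ 4) ^ᶠ 6     ≈⟨ *-congˡ (^-congˡ 6 z⁴≈4) ⟩
      z * ⟦ # 4 ⟧₅ ^ᶠ 6     ≈⟨ solve 1 (λ z → z :* con (# 4) :^ 6 := z) refl z ⟩
      z                     ∎

    z^5^odd≈z⁵ : ∀ j → z ^ᶠ (5 ^ suc (j ℕ.* 2)) ≈ z ^ᶠ 5
    z^5^odd≈z⁵ zero    = refl
    z^5^odd≈z⁵ (suc j) = begin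
      z ^ᶠ (5 ℕ.* (5 ℕ.* 5 ^ suc (j ℕ.* 2)))    ≈⟨ ^-assocʳ z 5 (5 ℕ.* 5 ^ suc (j ℕ.* 2)) ⟨
      (z ^ᶠ 5) ^ᶠ (5 ℕ.* 5 ^ suc (j ℕ.* 2))     ≈⟨ ^-assocʳ (z ^ᶠ 5) 5 (5 ^ suc (j ℕ.* 2)) ⟨
      ((z ^ᶠ 5) ^ᶠ 5) ^ᶠ (5 ^ suc (j ℕ.* 2))    ≈⟨ ^-congˡ (5 ^ suc (j ℕ.* 2)) z²⁵≈z ⟩
      z ^ᶠ (5 ^ suc (j ℕ.* 2))                  ≈⟨ z^5^odd≈z⁵ j ⟩
      z ^ᶠ 5                                    ∎

    z⁵≈z : z ^ᶠ 5 ≈ z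
    z⁵≈z with odd⇒1+2* odd
    ... | j , ≡.refl = trans (sym (z^5^odd≈z⁵ j)) (fermat z≉0)

  -- The form is the norm form for a square root of 2. If `b` is nonzero, then (a / b)² = 2, so that
  -- (a / b)⁴ = 4 = - 1, which is excluded.
  a²-2b²≈0⇒a≈0×b≈0 : ∀ {a b} → a ^ᶠ 2 - ⟦ # 2 ⟧₅ * b ^ᶠ 2 ≈ 0# → a ≈ 0# × b ≈ 0#
  a²-2b²≈0⇒a≈0×b≈0 {a} {b} a²-2b²≈0 with b ≟ 0#
  ... | yes b≈0 = x^n≈0⇒x≈0 2 (begin
    a ^ᶠ 2                 ≈⟨ x∙y⁻¹≈ε⇒x≈y _ _ a²-2b²≈0 ⟩
    ⟦ # 2 ⟧₅ * b ^ᶠ 2      ≈⟨ *-congˡ (^-congˡ 2 b≈0) ⟩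
    ⟦ # 2 ⟧₅ * 0# ^ᶠ 2     ≈⟨ *-congˡ (zeroˡ _) ⟩
    ⟦ # 2 ⟧₅ * 0#          ≈⟨ zeroʳ _ ⟩
    0#                     ∎) , b≈0
  ... | no b≉0 = contradiction (begin
    (a * b⁻¹) ^ᶠ 4                           ≈⟨ solve 2 (λ a c → (a :* c) :^ 4 := (a :^ 2) :^ 2 :* c :^ 4) refl a b⁻¹ ⟩
    (a ^ᶠ 2) ^ᶠ 2 * b⁻¹ ^ᶠ 4                 ≈⟨ *-congʳ (^-congˡ 2 (x∙y⁻¹≈ε⇒x≈y _ _ a²-2b²≈0)) ⟩
    (⟦ # 2 ⟧₅ * b ^ᶠ 2) ^ᶠ 2 * b⁻¹ ^ᶠ 4      ≈⟨ solve 2 (λ b c → (con (# 2) :* b :^ 2) :^ 2 :* c :^ 4 := con (# 4) :* (c :* b) :^ 4) refl b b⁻¹ ⟩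
    ⟦ # 4 ⟧₅ * (b⁻¹ * b) ^ᶠ 4                ≈⟨ *-congˡ (^-congˡ 4 b⁻¹b≈1) ⟩
    ⟦ # 4 ⟧₅ * 1# ^ᶠ 4                       ≈⟨ *-congˡ 1^4≈1 ⟩
    ⟦ # 4 ⟧₅ * 1#                            ≈⟨ *-identityʳ _ ⟩
    ⟦ # 4 ⟧₅                                 ∎) z⁴≉-1
    where
    b⁻¹ : Carrier
    b⁻¹ = inverse F b b≉0

    b⁻¹b≈1 : b⁻¹ * b ≈ 1#
    b⁻¹b≈1 = proj₁ (proj₂ (≉0⇒invertible b≉0))

    1^4≈1 : 1# ^ᶠ 4 ≈ 1#
    -- A product of four ones over `Fin 4` unfolds to the same term as `1# ^ᶠ 4`.
    1^4≈1 = ∏.sum-replicate-zero 4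

  -- Nonvanishing denominators and the scaling of the variable.

  num den : Carrier → Carrier → Carrier → Carrier
  num a b x = x * den a b x
  den a b x = (x ^ᶠ 2 + a * x + b) ^ᶠ 2

  den-cong : ∀ {a a′ b b′ x x′} → a ≈ a′ → b ≈ b′ → x ≈ x′ → den a b x ≈ den a′ b′ x′
  den-cong a≈a′ b≈b′ x≈x′ =
    ^-congˡ 2 (+-cong (+-cong (^-congˡ 2 x≈x′) (*-cong a≈a′ x≈x′)) b≈b′)

  num-cong : ∀ {a a′ b b′ x x′} → a ≈ a′ → b ≈ b′ → x ≈ x′ → num a b x ≈ num a′ b′ x′
  num-cong a≈a′ b≈b′ x≈x′ = *-cong x≈x′ (den-cong a≈a′ b≈b′ x≈x′)

  -- Modulo 5 the discriminant C² - 4 D is C² + D, and its square being - 1 says that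
  -- it is 2 or 3, the nonsquares of 𝔽₅.
  NonsquareDiscriminant : 𝔽₅ → 𝔽₅ → Set
  NonsquareDiscriminant C D = (C *₅ C +₅ D) *₅ (C *₅ C +₅ D) ≡ # 4

  -- Completing the square modulo 5: (2x + C)² = 4ε + (C² + D), where ε is the quadratic. At a zero
  -- of ε, squaring once more makes (2x + C)⁴ the square of the discriminant, that is - 1.
  den≉0 : ∀ C D → NonsquareDiscriminant C D → ∀ x → ¬ (den ⟦ C ⟧₅ ⟦ D ⟧₅ x ≈ 0#)
  den≉0 C D disc x den≈0 = z⁴≉-1 (begin
    (⟦ # 2 ⟧₅ * x + γ) ^ᶠ 4                  ≈⟨ solve 3 (λ x c d → (con (# 2) :* x :+ c) :^ 4 :=
                                                  (x :^ 2 :+ c :* x :+ d)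
                                                    :* (x :^ 2 :+ c :* x :+ d :+ con (# 3) :* (c :* c :+ d))
                                                  :+ (c :* c :+ d) :* (c :* c :+ d)) refl x γ δ ⟩
    ε * (ε + ⟦ # 3 ⟧₅ * (γ * γ + δ)) + (γ * γ + δ) * (γ * γ + δ)
                                             ≈⟨ +-cong (trans (*-congʳ (x^n≈0⇒x≈0 2 den≈0)) (zeroˡ _)) (sym disc-homo) ⟩
    0# + ⟦ # 4 ⟧₅                            ≈⟨ +-identityˡ _ ⟩
    ⟦ # 4 ⟧₅                                 ∎)
    where
    γ δ ε : Carrier
    γ = ⟦ C ⟧₅
    δ = ⟦ D ⟧₅
    ε = x ^ᶠ 2 + γ * x + δ

    γ²+δ : ⟦ C *₅ C +₅ D ⟧₅ ≈ γ * γ + δ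
    γ²+δ = trans (⟦⟧₅-homo-+ (C *₅ C) D) (+-congʳ (⟦⟧₅-homo-* C C))

    disc-homo : ⟦ # 4 ⟧₅ ≈ (γ * γ + δ) * (γ * γ + δ)
    disc-homo = begin
      ⟦ # 4 ⟧₅                                    ≡⟨ ≡.cong ⟦_⟧₅ disc ⟨
      ⟦ (C *₅ C +₅ D) *₅ (C *₅ C +₅ D) ⟧₅         ≈⟨ ⟦⟧₅-homo-* (C *₅ C +₅ D) (C *₅ C +₅ D) ⟩
      ⟦ C *₅ C +₅ D ⟧₅ * ⟦ C *₅ C +₅ D ⟧₅         ≈⟨ *-cong γ²+δ γ²+δ ⟩
      (γ * γ + δ) * (γ * γ + δ)                   ∎

  record CrossInjective (A B C D : 𝔽₅) : Set (c ⊔ ℓ) where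
    constructor crossInjective
    field injective : ∀ {x y} →
            num ⟦ A ⟧₅ ⟦ B ⟧₅ x * den ⟦ C ⟧₅ ⟦ D ⟧₅ y ≈ num ⟦ A ⟧₅ ⟦ B ⟧₅ y * den ⟦ C ⟧₅ ⟦ D ⟧₅ x →
            x ≈ y

  g-permutes : ∀ {A B C D} → NonsquareDiscriminant C D → CrossInjective A B C D →
    Permutes F (g F A B C D)
  g-permutes {C = C} {D} disc (crossInjective injective) =
    permutes (num-cong refl refl) (den-cong refl refl) (den≉0 C D disc) injective

  -- Give `x` weight 1, `A` and `C` weight 1, `B` and `D` weight 2: the numerator is then
  -- homogeneous of weight 5 and the denominator of weight 4. Replacing `x` by `m x` thus multiplies
  -- each cross product by the ninth power of `m`.
  unscale : ∀ A B C D m m⁻¹ → m *₅ m⁻¹ ≡ # 1 →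
    CrossInjective (m *₅ A) (m *₅ m *₅ B) (m *₅ C) (m *₅ m *₅ D) → CrossInjective A B C D
  unscale A B C D m m⁻¹ mm⁻¹≡1 (crossInjective injective) =
    crossInjective λ {x} {y} eq → *-cancelˡ-≉0 (⟦unit⟧₅≉0 m m⁻¹ mm⁻¹≡1) (injective (begin
      num (⟦ m *₅ A ⟧₅) (⟦ m *₅ m *₅ B ⟧₅) (μ * x) * den (⟦ m *₅ C ⟧₅) (⟦ m *₅ m *₅ D ⟧₅) (μ * y)
        ≈⟨ scale x y ⟩
      μ ^ᶠ 9 * (num ⟦ A ⟧₅ ⟦ B ⟧₅ x * den ⟦ C ⟧₅ ⟦ D ⟧₅ y)
        ≈⟨ *-congˡ eq ⟩
      μ ^ᶠ 9 * (num ⟦ A ⟧₅ ⟦ B ⟧₅ y * den ⟦ C ⟧₅ ⟦ D ⟧₅ x)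
        ≈⟨ scale y x ⟨
      num (⟦ m *₅ A ⟧₅) (⟦ m *₅ m *₅ B ⟧₅) (μ * y) * den (⟦ m *₅ C ⟧₅) (⟦ m *₅ m *₅ D ⟧₅) (μ * x)
        ∎))
    where
    μ : Carrier
    μ = ⟦ m ⟧₅

    linear : ∀ A → ⟦ m *₅ A ⟧₅ ≈ μ * ⟦ A ⟧₅
    linear = ⟦⟧₅-homo-* m

    quadratic : ∀ B → ⟦ m *₅ m *₅ B ⟧₅ ≈ μ * μ * ⟦ B ⟧₅
    quadratic B = trans (⟦⟧₅-homo-* (m *₅ m) B) (*-congʳ (⟦⟧₅-homo-* m m))

    den-scale : ∀ a b x → den (μ * a) (μ * μ * b) (μ * x) ≈ μ ^ᶠ 4 * den a b x
    den-scale = solve 4 (λ m a b x →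
      ((m :* x) :^ 2 :+ m :* a :* (m :* x) :+ m :* m :* b) :^ 2
      := m :^ 4 :* (x :^ 2 :+ a :* x :+ b) :^ 2) refl μ

    scale : ∀ x y →
      num (⟦ m *₅ A ⟧₅) (⟦ m *₅ m *₅ B ⟧₅) (μ * x) * den (⟦ m *₅ C ⟧₅) (⟦ m *₅ m *₅ D ⟧₅) (μ * y)
      ≈ μ ^ᶠ 9 * (num ⟦ A ⟧₅ ⟦ B ⟧₅ x * den ⟦ C ⟧₅ ⟦ D ⟧₅ y)
    scale x y = begin
      num (⟦ m *₅ A ⟧₅) (⟦ m *₅ m *₅ B ⟧₅) (μ * x) * den (⟦ m *₅ C ⟧₅) (⟦ m *₅ m *₅ D ⟧₅) (μ * y)
        ≈⟨ *-cong (num-cong (linear A) (quadratic B) refl) (den-cong (linear C) (quadratic D) refl) ⟩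
      μ * x * den (μ * ⟦ A ⟧₅) (μ * μ * ⟦ B ⟧₅) (μ * x) * den (μ * ⟦ C ⟧₅) (μ * μ * ⟦ D ⟧₅) (μ * y)
        ≈⟨ *-cong (*-congˡ (den-scale ⟦ A ⟧₅ ⟦ B ⟧₅ x)) (den-scale ⟦ C ⟧₅ ⟦ D ⟧₅ y) ⟩
      μ * x * (μ ^ᶠ 4 * den ⟦ A ⟧₅ ⟦ B ⟧₅ x) * (μ ^ᶠ 4 * den ⟦ C ⟧₅ ⟦ D ⟧₅ y)
        ≈⟨ solve 4 (λ m x u v → m :* x :* (m :^ 4 :* u) :* (m :^ 4 :* v) := m :^ 9 :* (x :* u :* v)) refl μ x _ _ ⟩
      μ ^ᶠ 9 * (num ⟦ A ⟧₅ ⟦ B ⟧₅ x * den ⟦ C ⟧₅ ⟦ D ⟧₅ y)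
        ∎

  -- Polynomial certificates in two variables.

  -- A record rather than a synonym: the type checker would otherwise normalise
  -- polynomials with unknown coefficients when comparing such equations.
  infix 4 _≡ₚ_
  record _≡ₚ_ {n} (u v : Polynomial n) : Set where
    constructor normal
    field normalise-≡ : normalise u ≡ normalise v

  ⟦⟧-≡ₚ : ∀ {n} {u v : Polynomial n} → u ≡ₚ v → ∀ ρ → ⟦ u ⟧ ρ ≈ ⟦ v ⟧ ρ
  ⟦⟧-≡ₚ {u = u} {v} (normal u≡v) ρ = prove ρ u v (reflexive (≡.cong (λ n → ⟦ n ⟧N ρ) u≡v))

  -- The cross difference N(x) D(y) - N(y) D(x) is antisymmetric, so its cofactor of x - y is
  -- symmetric; the factors below are written in s = x + y and p = x y.
  xₚ yₚ sₚ pₚ : Polynomial 2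
  xₚ = var (# 0)
  yₚ = var (# 1)
  sₚ = xₚ :+ yₚ
  pₚ = xₚ :* yₚ

  numₚ denₚ : 𝔽₅ → 𝔽₅ → Polynomial 2 → Polynomial 2
  numₚ A B x = x :* denₚ A B x
  denₚ A B x = (x :^ 2 :+ con A :* x :+ con B) :^ 2

  NoCommonZero : Polynomial 2 → Polynomial 2 → Set _
  NoCommonZero P Q = ∀ ρ → ⟦ P ⟧ ρ ≈ 0# → ⟦ Q ⟧ ρ ≈ 0# → ⊥

  -- `con (# 4)` is - 1: at a common zero the certificate would make `Z` a fourth root of - 1.
  noCommonZero : ∀ Z U V P Q → Z :^ 4 ≡ₚ U :* P :+ V :* Q :+ con (# 4) → NoCommonZero P Q
  noCommonZero Z U V P Q eq ρ P≈0 Q≈0 = z⁴≉-1 (begin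
    ⟦ Z ⟧ ρ ^ᶠ 4                                          ≈⟨ ⟦⟧-≡ₚ eq ρ ⟩
    ⟦ U ⟧ ρ * ⟦ P ⟧ ρ + ⟦ V ⟧ ρ * ⟦ Q ⟧ ρ + ⟦ # 4 ⟧₅      ≈⟨ +-congʳ (+-cong (*-congˡ P≈0) (*-congˡ Q≈0)) ⟩
    ⟦ U ⟧ ρ * 0# + ⟦ V ⟧ ρ * 0# + ⟦ # 4 ⟧₅                ≈⟨ +-congʳ (+-cong (zeroʳ _) (zeroʳ _)) ⟩
    0# + 0# + ⟦ # 4 ⟧₅                                    ≈⟨ trans (+-congʳ (+-identityˡ _)) (+-identityˡ _) ⟩
    ⟦ # 4 ⟧₅                                              ∎)

  norm⇒crossInjective : ∀ {A B C D} P Q →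
    numₚ A B xₚ :* denₚ C D yₚ :- numₚ A B yₚ :* denₚ C D xₚ
      ≡ₚ con (# 4) :* (xₚ :- yₚ) :* (P :^ 2 :- con (# 2) :* Q :^ 2) →
    NoCommonZero P Q → CrossInjective A B C D
  norm⇒crossInjective P Q eq noZero = crossInjective λ {x} {y} cross →
    let ρ = x ∷ y ∷ [] in
    [ [ (λ 4≈0 → contradiction 4≈0 (⟦unit⟧₅≉0 (# 4) (# 4) ≡.refl)) , x∙y⁻¹≈ε⇒x≈y x y ]′
      ∘ xy≈0⇒x≈0∨y≈0
    , (λ norm≈0 → let P≈0 , Q≈0 = a²-2b²≈0⇒a≈0×b≈0 norm≈0
                  in contradiction Q≈0 (noZero ρ P≈0))
    ]′ (xy≈0⇒x≈0∨y≈0 (trans (sym (⟦⟧-≡ₚ eq ρ)) (x≈y⇒x∙y⁻¹≈ε cross)))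

  -- Certificates for the three base tuples.

  crossInjective-4212 : CrossInjective (# 4) (# 2) (# 1) (# 2)
  -- Modulo 5, (x - y)⁴ = (s² + p)², so the multipliers `U` and `V` can be symmetric too.
  crossInjective-4212 = norm⇒crossInjective P Q (normal ≡.refl) (noCommonZero (xₚ :- yₚ) U V P Q (normal ≡.refl))
    where
    P Q U V : Polynomial 2
    P = con (# 1) :+ con (# 4) :* sₚ :+ pₚ :+ sₚ :^ 2 :+ con (# 3) :* sₚ :* pₚ :+ con (# 4) :* pₚ :^ 2
    Q = con (# 1) :+ con (# 3) :* sₚ :+ con (# 4) :* pₚ :+ sₚ :* pₚ :+ con (# 4) :* pₚ :^ 2
    U = con (# 4) :+ sₚ :+ sₚ :^ 2 :+ con (# 2) :* sₚ :* pₚ :+ con (# 4) :* pₚ :^ 2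
    V = con (# 2) :+ con (# 2) :* sₚ :+ con (# 3) :* pₚ :+ sₚ :* pₚ :+ pₚ :^ 2

  crossInjective-0203 : CrossInjective (# 0) (# 2) (# 0) (# 3)
  crossInjective-0203 = norm⇒crossInjective P Q (normal ≡.refl) (noCommonZero (xₚ :- yₚ) U V P Q (normal ≡.refl))
    where
    P Q U V : Polynomial 2
    P = con (# 3) :+ sₚ :^ 2 :+ con (# 3) :* pₚ :^ 2
    Q = sₚ :+ sₚ :* pₚ
    U = con (# 2) :+ sₚ :^ 2
    V = con (# 2) :* sₚ :* pₚ

  -- Here P - Q = L s, so that a common zero of P and Q is one of Q and s or one of Q and L.
  crossInjective-4233 : CrossInjective (# 4) (# 2) (# 3) (# 3)
  crossInjective-4233 = norm⇒crossInjective (Q :+ L :* sₚ) Q (normal ≡.refl) λ ρ P≈0 Q≈0 →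
    [ (λ L≈0 → noCommonZero (xₚ :- yₚ) U V L Q (normal ≡.refl) ρ L≈0 Q≈0)
    -- At s = 0, `Q` becomes p² - p + 1, of discriminant - 3 = 2. Completing the square gives (2p -
    -- 1)² = 2 at its zeros, whence (2p - 1)⁴ = - 1. The factor 2 + 3p cancels the part of `Q`
    -- divisible by s.
    , (λ s≈0 → noCommonZero (con (# 2) :* pₚ :- con (# 1)) (V′ :* (con (# 2) :+ con (# 3) :* pₚ)) V′ sₚ Q
                 (normal ≡.refl) ρ s≈0 Q≈0) ]′
    (xy≈0⇒x≈0∨y≈0 (begin
      ⟦ L ⟧ ρ * ⟦ sₚ ⟧ ρ              ≈⟨ +-identityˡ _ ⟨
      0# + ⟦ L ⟧ ρ * ⟦ sₚ ⟧ ρ         ≈⟨ +-congʳ Q≈0 ⟨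
      ⟦ Q ⟧ ρ + ⟦ L ⟧ ρ * ⟦ sₚ ⟧ ρ    ≈⟨ P≈0 ⟩
      0#                             ∎))
    where
    L Q U V V′ : Polynomial 2
    L = con (# 1) :+ sₚ :- pₚ
    Q = con (# 1) :+ con (# 3) :* sₚ :+ con (# 4) :* pₚ :+ con (# 2) :* sₚ :* pₚ :+ pₚ :^ 2
    U = con (# 2) :+ sₚ :+ con (# 4) :* sₚ :^ 2 :+ sₚ :^ 3 :+ sₚ :^ 2 :* pₚ
          :+ pₚ :^ 2 :+ sₚ :* pₚ :^ 2 :+ con (# 2) :* pₚ :^ 3
    V = con (# 4) :+ pₚ :+ con (# 2) :* pₚ :^ 2
    V′ = con (# 2) :+ con (# 4) :* pₚ :+ pₚ :^ 2

-- Reduction of the ten tuples to the base cases.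

proposition3p1 : ∀ {c ℓ : Level} (k : ℕ) → 0 < k → Odd k →
    (F : FiniteField c ℓ (5 ^ k)) (A B C D : 𝔽₅) →
    (A , B , C , D) ∈ tuples → Permutes F (g F A B C D)
proposition3p1 k _ odd F A B C D = cases
  where
  open OddDegreeOver𝔽₅ {k = k} F odd

  cases : ∀ {A B C D} → (A , B , C , D) ∈ tuples → Permutes F (g F A B C D)
  cases (here ≡.refl) = g-permutes ≡.refl crossInjective-4212
  cases (there (here ≡.refl)) = g-permutes ≡.refl crossInjective-4233
  -- Here and below, `m` is the solution of m A = 4 modulo 5 when A is nonzero; for A = 0 it is 2,
  -- whose square - 1 exchanges 2 and 3.
  cases (there (there (here ≡.refl))) =
    g-permutes ≡.refl (unscale (# 2) (# 3) (# 4) (# 2) (# 2) (# 3) ≡.refl crossInjective-4233)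
  cases (there (there (there (here ≡.refl)))) =
    g-permutes ≡.refl (unscale (# 2) (# 3) (# 3) (# 3) (# 2) (# 3) ≡.refl crossInjective-4212)
  cases (there (there (there (there (here ≡.refl))))) =
    g-permutes ≡.refl (unscale (# 1) (# 2) (# 4) (# 2) (# 4) (# 4) ≡.refl crossInjective-4212)
  cases (there (there (there (there (there (here ≡.refl)))))) =
    g-permutes ≡.refl (unscale (# 1) (# 2) (# 2) (# 3) (# 4) (# 4) ≡.refl crossInjective-4233)
  cases (there (there (there (there (there (there (here ≡.refl))))))) =
    g-permutes ≡.refl (unscale (# 3) (# 3) (# 1) (# 2) (# 3) (# 2) ≡.refl crossInjective-4233)
  cases (there (there (there (there (there (there (there (here ≡.refl)))))))) =
    g-permutes ≡.refl (unscale (# 3) (# 3) (# 2) (# 3) (# 3) (# 2) ≡.refl crossInjective-4212)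
  cases (there (there (there (there (there (there (there (there (here ≡.refl))))))))) =
    g-permutes ≡.refl (unscale (# 0) (# 3) (# 0) (# 2) (# 2) (# 3) ≡.refl crossInjective-0203)
  cases (there (there (there (there (there (there (there (there (there (here ≡.refl)))))))))) =
    g-permutes ≡.refl crossInjective-0203
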